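{- A complete bipartite preference structure $I=(M,W,\{\succ_m\}_{m\in M},\{\succ_w\}_{w\in W})$ of size four is cube-distance-compatible if and only if it has a perfect matching of mutually last-ranked pairs, i.e. there is a bijection $\pi:M\to W$ such that $(m,\pi(m))$ is a mutually last-ranked pair for every $m\in M$.
   Context: A complete bipartite preference structure of size $k$ is a tuple $I=(M,W,\{\succ_m\}_{m\in M},\{\succ_w\}_{w\in W})$, where $M$ and $W$ are disjoint finite sets with $|M|=|W|=k$, each $\succ_m$ is a strict total order on $W$, and each $\succ_w$ is a strict total order on $M$. The elements of $M\cup W$ are called agents; each agent ranks the agents of the opposite side by its order. The cube graph $Q_3$ has vertex set $\{0,1\}^3$, two vertices being adjacent if and only if they differ in exactly one coordinate. It is bipartite with two classes of size four (even-parity and odd-parity strings), and every vertex is adjacent to exactly three of the four vertices of the opposite class, so it has a unique non-neighbor in the opposite class. For $k=4$, a strong cube realization of $I$ consists of a graph isomorphic to $Q_3$ with bipartition classes $V_M,V_W$ (each of size four), together with bijections $M\to V_M$ and $W\to V_W$. The opposite-side non-neighbor of an agent is the agent of the other side placed at the unique non-adjacent vertex of the opposite class. A size-four complete bipartite preference structure is cube-distance-compatible if there is a strong cube realization such that, for every agent (in $M$ and in $W$), the unique opposite-side non-neighbor is ranked last by that agent. A pair $(m,w)\in M\times W$ is mutually last-ranked if $w$ is last in $m$'s preference order and $m$ is last in $w$'s preference order. -}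

module Defs where

open import Data.Bool using (Bool; true; false; not)
import Data.Bool.Properties as Bool
open import Data.Empty using (⊥-elim)
open import Data.Fin using (Fin; zero; suc)
import Data.Fin as Fin
open import Data.Nat using (ℕ)
open import Data.Product using (Σ; ∃; ∃!; _×_; _,_; proj₁; proj₂)
open import Data.Sum using (_⊎_; inj₁; inj₂)
open import Data.Vec using (Vec; []; _∷_; lookup; map; updateAt)
open import Data.Vec.Properties using (lookup∘updateAt; lookup∘updateAt′; lookup-map)
open import Function using (_∘_)
open import Function.Bundles using (_⤖_; _⇔_; Bijection; Equivalence)
open import Level using (0ℓ)
open import Relation.Binary using (Rel; IsStrictTotalOrder; Symmetric)
open import Relation.Binary.PropositionalEquality
open import Relation.Nullary using (¬_; yes; no)

record PreferenceStructure (k : ℕ) : Set₁ where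
  field
    M W   : Set
    M-size : M ⤖ Fin k
    W-size : W ⤖ Fin k
    -- prefM m w w′ means that m strictly prefers w to w′ (w ≻ₘ w′).
    prefM : M → Rel W 0ℓ
    prefW : W → Rel M 0ℓ
    prefM-strictTotal : ∀ m → IsStrictTotalOrder _≡_ (prefM m)
    prefW-strictTotal : ∀ w → IsStrictTotalOrder _≡_ (prefW w)

RankedLast : {A : Set} → Rel A 0ℓ → A → Set
RankedLast _≻_ x = ∀ y → y ≢ x → y ≻ x

MutuallyLast : ∀ {k} (I : PreferenceStructure k) →
               PreferenceStructure.M I → PreferenceStructure.W I → Set
MutuallyLast I m w = RankedLast (prefM m) w × RankedLast (prefW w) m
  where open PreferenceStructure I

record Graph : Set₁ where
  field
    Vertex : Set
    Adj    : Rel Vertex 0ℓ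
    symm   : Symmetric Adj
    irrefl : ∀ v → ¬ Adj v v

record _≅_ (G H : Graph) : Set where
  private
    module G = Graph G
    module H = Graph H
  field
    bijection : G.Vertex ⤖ H.Vertex
  open Bijection bijection public using (to; injective; strictlySurjective)
  field
    adj⇔ : ∀ u v → G.Adj u v ⇔ H.Adj (to u) (to v)

DifferInOne : ∀ {n} → Rel (Vec Bool n) 0ℓ
DifferInOne {n} u v = ∃! _≡_ λ (i : Fin n) → lookup u i ≢ lookup v i

Q₃ : Graph
Q₃ = record
  { Vertex = Vec Bool 3
  ; Adj    = DifferInOne
  ; symm   = λ (i , i≢ , uniq) → i , i≢ ∘ sym , λ j≢ → uniq (j≢ ∘ sym)
  ; irrefl = λ v (i , i≢ , _) → i≢ refl
  }

data Side : Set where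
  M-side W-side : Side

opposite : Side → Side
opposite M-side = W-side
opposite W-side = M-side

record Bipartition (G : Graph) : Set where
  open Graph G
  field
    side   : Vertex → Side
    proper : ∀ u v → Adj u v → side v ≡ opposite (side u)

  Class : Side → Set
  Class s = ∃ λ v → side v ≡ s

  OppositeNonAdjacent : Rel Vertex 0ℓ
  OppositeNonAdjacent v u = side u ≡ opposite (side v) × ¬ Adj v u

-- The following lemmas show that every vertex of a bipartitioned cube has a
-- unique non-neighbour in the opposite class, so that the non-neighbour of an agent is
-- a well-defined function.

opposite-involutive : ∀ s → opposite (opposite s) ≡ s
opposite-involutive M-side = refl
opposite-involutive W-side = refl

≢opposite : ∀ s → s ≢ opposite s
≢opposite M-side ()
≢opposite W-side ()

flip : ∀ {n} → Fin n → Vec Bool n → Vec Bool n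
flip i u = updateAt u i not

antipode : ∀ {n} → Vec Bool n → Vec Bool n
antipode = map not

flip-adj : ∀ {n} (i : Fin n) (u : Vec Bool n) → DifferInOne u (flip i u)
flip-adj i u =
  i , (λ eq → Bool.not-¬ refl (trans eq (lookup∘updateAt i u))) , unique
  where
  unique : ∀ {j} → lookup u j ≢ lookup (flip i u) j → i ≡ j
  unique {j} j≢ with i Fin.≟ j
  ... | yes i≡j = i≡j
  ... | no  i≢j = ⊥-elim (j≢ (sym (lookup∘updateAt′ j i (i≢j ∘ sym) u)))

¬antipode-adj : (u : Vec Bool 3) → ¬ DifferInOne u (antipode u)
¬antipode-adj u (i , _ , uniq) =
  0≢1 (trans (sym (uniq (differ zero))) (uniq (differ (suc zero))))
  where
  differ : ∀ j → lookup u j ≢ lookup (antipode u) j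
  differ j eq = Bool.not-¬ refl (trans eq (lookup-map j not u))

  0≢1 : ¬ (Fin.zero {2} ≡ suc zero)
  0≢1 ()

same-or-not : ∀ a b → b ≡ a ⊎ b ≡ not a
same-or-not false false = inj₁ refl
same-or-not false true  = inj₂ refl
same-or-not true  false = inj₂ refl
same-or-not true  true  = inj₁ refl

data CubePosition (u : Vec Bool 3) : Vec Bool 3 → Set where
  distance0 : CubePosition u u
  distance1 : ∀ i → CubePosition u (flip i u)
  distance2 : ∀ i j → CubePosition u (flip j (flip i u))
  distance3 : CubePosition u (antipode u)

cubePosition : ∀ u v → CubePosition u v
cubePosition (a ∷ b ∷ c ∷ []) (a′ ∷ b′ ∷ c′ ∷ [])
  with same-or-not a a′ | same-or-not b b′ | same-or-not c c′
... | inj₁ refl | inj₁ refl | inj₁ refl = distance0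
... | inj₂ refl | inj₁ refl | inj₁ refl = distance1 zero
... | inj₁ refl | inj₂ refl | inj₁ refl = distance1 (suc zero)
... | inj₁ refl | inj₁ refl | inj₂ refl = distance1 (suc (suc zero))
... | inj₂ refl | inj₂ refl | inj₁ refl = distance2 zero (suc zero)
... | inj₂ refl | inj₁ refl | inj₂ refl = distance2 zero (suc (suc zero))
... | inj₁ refl | inj₂ refl | inj₂ refl = distance2 (suc zero) (suc (suc zero))
... | inj₂ refl | inj₂ refl | inj₂ refl = distance3

module _ (B : Bipartition Q₃) where
  open Bipartition B

  side-flip : ∀ i u → side (flip i u) ≡ opposite (side u)
  side-flip i u = proper u (flip i u) (flip-adj i u)

  side-flip² : ∀ i j u → side (flip j (flip i u)) ≡ side u
  side-flip² i j u = begin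
    side (flip j (flip i u))      ≡⟨ side-flip j (flip i u) ⟩
    opposite (side (flip i u))    ≡⟨ cong opposite (side-flip i u) ⟩
    opposite (opposite (side u))  ≡⟨ opposite-involutive (side u) ⟩
    side u                        ∎
    where open ≡-Reasoning

  side-antipode : ∀ u → side (antipode u) ≡ opposite (side u)
  side-antipode u@(_ ∷ _ ∷ _ ∷ []) =
    trans (side-flip² (suc zero) (suc (suc zero)) (flip zero u)) (side-flip zero u)

  Q₃-uniqueNonNeighbour : ∀ u → ∃! _≡_ (OppositeNonAdjacent u)
  Q₃-uniqueNonNeighbour u =
    antipode u , (side-antipode u , ¬antipode-adj u) , λ {v} → unique v
    where
    unique : ∀ v → OppositeNonAdjacent u v → antipode u ≡ v
    unique v (opp , ¬adj) with cubePosition u v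
    ... | distance0     = ⊥-elim (≢opposite (side u) opp)
    ... | distance1 i   = ⊥-elim (¬adj (flip-adj i u))
    ... | distance2 i j = ⊥-elim (≢opposite (side u) (trans (sym (side-flip² i j u)) opp))
    ... | distance3     = refl

module _ {G : Graph} (φ : G ≅ Q₃) (B : Bipartition G) where
  open Graph G
  open Bipartition B
  open _≅_ φ

  private
    from : Vec Bool 3 → Vertex
    from x = proj₁ (strictlySurjective x)

    to-from : ∀ x → to (from x) ≡ x
    to-from x = proj₂ (strictlySurjective x)

    from-to : ∀ v → from (to v) ≡ v
    from-to v = injective (to-from (to v))

  transported : Bipartition Q₃
  transported = record
    { side   = side ∘ from
    ; proper = λ x y x~y → proper (from x) (from y)
        (Equivalence.from (adj⇔ (from x) (from y))
          (subst₂ DifferInOne (sym (to-from x)) (sym (to-from y)) x~y))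
    }

  uniqueNonNeighbour : ∀ v → ∃! _≡_ (OppositeNonAdjacent v)
  uniqueNonNeighbour v with Q₃-uniqueNonNeighbour transported (to v)
  ... | x , (opp , ¬adj) , uniq =
    from x
    , ( trans opp (cong (opposite ∘ side) (from-to v))
      , λ v~ → ¬adj (subst (DifferInOne (to v)) (to-from x)
                       (Equivalence.to (adj⇔ v (from x)) v~)))
    , λ {u} (opp′ , ¬adj′) →
        trans
          (cong from (uniq
            ( trans (cong side (from-to u))
                (trans opp′ (cong (opposite ∘ side) (sym (from-to v))))
            , λ q → ¬adj′ (Equivalence.from (adj⇔ v u) q))))
          (from-to u)

-- The classes have size four automatically, being in bijection with M and W.
record StrongCubeRealization (I : PreferenceStructure 4) : Set₁ where
  open PreferenceStructure I
  field
    graph       : Graph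
    isCube      : graph ≅ Q₃
    bipartition : Bipartition graph
  open Bipartition bipartition public
  field
    placeM : M ⤖ Class M-side
    placeW : W ⤖ Class W-side

  nonNeighbourVertex : ∀ {s} → Class s → Class (opposite s)
  nonNeighbourVertex (v , v∈s) =
    let u , (opp , _) , _ = uniqueNonNeighbour isCube bipartition v
    in  u , trans opp (cong opposite v∈s)

  nonNeighbourOfM : M → W
  nonNeighbourOfM m =
    proj₁ (Bijection.strictlySurjective placeW
            (nonNeighbourVertex (Bijection.to placeM m)))

  nonNeighbourOfW : W → M
  nonNeighbourOfW w =
    proj₁ (Bijection.strictlySurjective placeM
            (nonNeighbourVertex (Bijection.to placeW w)))

CubeDistanceCompatible : PreferenceStructure 4 → Set₁
CubeDistanceCompatible I =
  Σ (StrongCubeRealization I) λ R →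
    let open StrongCubeRealization R in
    (∀ m → RankedLast (prefM m) (nonNeighbourOfM m)) ×
    (∀ w → RankedLast (prefW w) (nonNeighbourOfW w))
  where open PreferenceStructure I

HasMutuallyLastPerfectMatching : ∀ {k} → PreferenceStructure k → Set
HasMutuallyLastPerfectMatching I =
  Σ (M ⤖ W) λ π → ∀ m → MutuallyLast I m (Bijection.to π m)
  where open PreferenceStructure I

{-# OPTIONS --safe #-}

-- The opposite-side non-neighbour of a vertex of Q₃ is its antipode, and non-adjacency is
-- symmetric, so the non-neighbour maps M → W and W → M of a realization are mutually
-- inverse: a compatible realization makes the first of them the matching π.  Conversely,
-- place M arbitrarily on the even vertices and put π m at the antipode of m.

module Submission where

open import Defs
open import Data.Bool using (Bool; true; false)
open import Data.Bool.Properties using (_≟_; ¬-not; not-involutive)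
open import Data.Fin using (Fin; zero; suc)
import Data.Fin as Fin
open import Data.Product using (_,_; proj₁; proj₂)
open import Data.Vec using (Vec; []; _∷_; lookup; tabulate)
open import Data.Vec.Properties
  using (lookup∘updateAt; lookup∘updateAt′; tabulate∘lookup; tabulate-cong; map-∘; map-cong; map-id)
open import Function.Bundles
  using (_⤖_; _⇔_; _↔_; Bijection; Inverse; mk⇔; mk↔ₛ′)
open import Function.Construct.Composition using (_↔-∘_)
open import Function.Construct.Identity using (⤖-id; ⇔-id)
open import Function.Construct.Symmetry using (↔-sym)
open import Function.Properties.Bijection using (⤖⇒↔)
open import Function.Properties.Inverse using (↔⇒⤖)
open import Relation.Binary.PropositionalEquality
open import Relation.Binary.PropositionalEquality.WithK using (≡-irrelevant)
open import Relation.Nullary using (yes; no)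
open import Relation.Nullary.Decidable using (decidable-stable)

open Bijection using (to; injective; strictlySurjective)

module _ {G : Graph} (B : Bipartition G) where
  open Graph G
  open Bipartition B

  oppositeNonAdjacent-sym : ∀ {u v} → OppositeNonAdjacent u v → OppositeNonAdjacent v u
  oppositeNonAdjacent-sym {u} (opp , ¬adj) =
    trans (sym (opposite-involutive (side u))) (cong opposite (sym opp)) ,
    λ v~u → ¬adj (symm v~u)

  -- The side component is an equality proof, unique by K, so a class member is determined by its
  -- vertex.
  Class-≡ : ∀ {s} {x y : Class s} → proj₁ x ≡ proj₁ y → x ≡ y
  Class-≡ {x = v , p} {y = _ , q} refl = cong (v ,_) (≡-irrelevant p q)

module _ {I : PreferenceStructure 4} (R : StrongCubeRealization I) where
  open PreferenceStructure I
  open StrongCubeRealization R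

  -- Kept generic in the side `s`: since `opposite` computes on each concrete side, the two
  -- instances unfold to `nonNeighbourOfM` and `nonNeighbourOfW`.
  module NonNeighbour {A B : Set} {s : Side}
      (placeA : A ⤖ Class s) (placeB : B ⤖ Class (opposite s)) where

    nonNeighbour : A → B
    nonNeighbour a = proj₁ (strictlySurjective placeB (nonNeighbourVertex (to placeA a)))

    nonNeighbour-sound : ∀ a →
      OppositeNonAdjacent (proj₁ (to placeA a)) (proj₁ (to placeB (nonNeighbour a)))
    nonNeighbour-sound a =
      subst (OppositeNonAdjacent v)
        (cong proj₁ (sym (proj₂ (strictlySurjective placeB (nonNeighbourVertex (to placeA a))))))
        (proj₁ (proj₂ (uniqueNonNeighbour isCube bipartition v)))
      where v = proj₁ (to placeA a)

    -- The cube has only one candidate vertex, and `placeB` is injective, so exhibiting one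
    -- non-adjacent opposite agent identifies the chosen one.
    nonNeighbour-unique : ∀ {a b} →
      OppositeNonAdjacent (proj₁ (to placeA a)) (proj₁ (to placeB b)) → nonNeighbour a ≡ b
    nonNeighbour-unique {a} non = injective placeB
      (trans (proj₂ (strictlySurjective placeB (nonNeighbourVertex (to placeA a))))
        (Class-≡ bipartition
          (proj₂ (proj₂ (uniqueNonNeighbour isCube bipartition (proj₁ (to placeA a)))) non)))

  module OfM = NonNeighbour placeM placeW
  module OfW = NonNeighbour placeW placeM

  nonNeighbourOfW-ofM : ∀ m → nonNeighbourOfW (nonNeighbourOfM m) ≡ m
  nonNeighbourOfW-ofM m =
    OfW.nonNeighbour-unique (oppositeNonAdjacent-sym bipartition (OfM.nonNeighbour-sound m))

  nonNeighbourOfM-ofW : ∀ w → nonNeighbourOfM (nonNeighbourOfW w) ≡ w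
  nonNeighbourOfM-ofW w =
    OfM.nonNeighbour-unique (oppositeNonAdjacent-sym bipartition (OfW.nonNeighbour-sound w))

  nonNeighbour-⤖ : M ⤖ W
  nonNeighbour-⤖ = ↔⇒⤖
    (mk↔ₛ′ nonNeighbourOfM nonNeighbourOfW nonNeighbourOfM-ofW nonNeighbourOfW-ofM)

parity : ∀ {n} → Vec Bool n → Side
parity []          = M-side
parity (false ∷ u) = parity u
parity (true  ∷ u) = opposite (parity u)

parity-flip : ∀ {n} (i : Fin n) u → parity (flip i u) ≡ opposite (parity u)
parity-flip zero    (false ∷ u) = refl
parity-flip zero    (true  ∷ u) = sym (opposite-involutive (parity u))
parity-flip (suc i) (false ∷ u) = parity-flip i u
parity-flip (suc i) (true  ∷ u) = cong opposite (parity-flip i u)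

-- Distinct Booleans are negations of each other, which settles coordinate `i`; elsewhere the
-- uniqueness of `i` forces agreement. This reduces properness of the parity colouring to single
-- flips.
differInOne⇒flip : ∀ {n} (u v : Vec Bool n) ((i , _) : DifferInOne u v) → v ≡ flip i u
differInOne⇒flip u v (i , i≢ , uniq) = begin
  v                              ≡⟨ tabulate∘lookup v ⟨
  tabulate (lookup v)            ≡⟨ tabulate-cong pointwise ⟩
  tabulate (lookup (flip i u))   ≡⟨ tabulate∘lookup (flip i u) ⟩
  flip i u                       ∎
  where
  open ≡-Reasoning
  pointwise : ∀ j → lookup v j ≡ lookup (flip i u) j
  pointwise j with i Fin.≟ j
  ... | yes refl = trans (¬-not (≢-sym i≢)) (sym (lookup∘updateAt i u))
  ... | no  i≢j  = trans
    -- Uniqueness only refutes a difference at `j`; decidable equality of Booleans turns this into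
    -- an equation.
    (sym (decidable-stable (lookup u j ≟ lookup v j) (λ j≢ → i≢j (uniq j≢))))
    (sym (lookup∘updateAt′ j i (≢-sym i≢j) u))

parityBipartition : Bipartition Q₃
parityBipartition = record
  { side   = parity
  ; proper = λ u v u~v@(i , _) → trans (cong parity (differInOne⇒flip u v u~v)) (parity-flip i u)
  }

open Bipartition parityBipartition using (Class; OppositeNonAdjacent)

antipode-involutive : ∀ {n} (u : Vec Bool n) → antipode (antipode u) ≡ u
antipode-involutive u =
  trans (sym (map-∘ _ _ u)) (trans (map-cong not-involutive u) (map-id u))

oppositeNonAdjacent-antipode : ∀ u → OppositeNonAdjacent u (antipode u)
oppositeNonAdjacent-antipode u = side-antipode parityBipartition u , ¬antipode-adj u

-- The antipode amounts to three flips, an odd number, so it exchanges the classes.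
antipodeClass : ∀ {s} → Class s → Class (opposite s)
antipodeClass (u , u∈s) =
  antipode u , trans (side-antipode parityBipartition u) (cong opposite u∈s)

even↔odd : Class M-side ↔ Class W-side
even↔odd = mk↔ₛ′ antipodeClass antipodeClass
  (λ (u , _) → Class-≡ parityBipartition (antipode-involutive u))
  (λ (u , _) → Class-≡ parityBipartition (antipode-involutive u))

-- The third bit of an even vertex is the sum of the first two modulo 2, so `index` reads only those
-- two.
Fin4↔even : Fin 4 ↔ Class M-side
Fin4↔even = mk↔ₛ′ vertex index vertex-index index-vertex
  where
  vertex : Fin 4 → Class M-side
  vertex zero                   = false ∷ false ∷ false ∷ [] , refl
  vertex (suc zero)             = false ∷ true  ∷ true  ∷ [] , refl
  vertex (suc (suc zero))       = true  ∷ false ∷ true  ∷ [] , refl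
  vertex (suc (suc (suc zero))) = true  ∷ true  ∷ false ∷ [] , refl

  index : Class M-side → Fin 4
  index (false ∷ false ∷ _ , _) = zero
  index (false ∷ true  ∷ _ , _) = suc zero
  index (true  ∷ false ∷ _ , _) = suc (suc zero)
  index (true  ∷ true  ∷ _ , _) = suc (suc (suc zero))

  vertex-index : ∀ x → vertex (index x) ≡ x
  vertex-index (false ∷ false ∷ false ∷ [] , refl) = refl
  vertex-index (false ∷ true  ∷ true  ∷ [] , refl) = refl
  vertex-index (true  ∷ false ∷ true  ∷ [] , refl) = refl
  vertex-index (true  ∷ true  ∷ false ∷ [] , refl) = refl

  index-vertex : ∀ i → index (vertex i) ≡ i
  index-vertex zero                   = refl
  index-vertex (suc zero)             = refl
  index-vertex (suc (suc zero))       = refl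
  index-vertex (suc (suc (suc zero))) = refl

module _ (I : PreferenceStructure 4) where
  open PreferenceStructure I

  compatible⇒matching : CubeDistanceCompatible I → HasMutuallyLastPerfectMatching I
  compatible⇒matching (R , lastM , lastW) =
    nonNeighbour-⤖ R , λ m →
      lastM m ,
      -- The partner of `m` ranks its own non-neighbour last, and that agent is `m` again.
      subst (RankedLast (prefW (nonNeighbourOfM m))) (nonNeighbourOfW-ofM R m)
        (lastW (nonNeighbourOfM m))
    where open StrongCubeRealization R

  module _ (π : M ⤖ W) where
    private
      π↔ = ⤖⇒↔ π
      M↔even = Fin4↔even ↔-∘ ⤖⇒↔ M-size

    antipodalRealization : StrongCubeRealization I
    antipodalRealization = record
      { graph       = Q₃
      ; isCube      = record { bijection = ⤖-id _ ; adj⇔ = λ _ _ → ⇔-id _ }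
      ; bipartition = parityBipartition
      ; placeM      = ↔⇒⤖ M↔even
      -- Each `w` goes to the antipode of the vertex of its partner under `π`.
      ; placeW      = ↔⇒⤖ (even↔odd ↔-∘ (M↔even ↔-∘ ↔-sym π↔))
      }

    open StrongCubeRealization antipodalRealization using (nonNeighbourOfM; nonNeighbourOfW)

    -- This direction comes first because the vertex of `w` is by definition the antipode of its
    -- partner's vertex; starting from `m` would require cancelling `π` first.
    nonNeighbourOfW≡π⁻¹ : ∀ w → nonNeighbourOfW w ≡ Inverse.from π↔ w
    nonNeighbourOfW≡π⁻¹ w = OfW.nonNeighbour-unique antipodalRealization
      (oppositeNonAdjacent-sym parityBipartition {u} {antipode u}
        (oppositeNonAdjacent-antipode u))
      where u = proj₁ (Inverse.to M↔even (Inverse.from π↔ w))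

    π-nonNeighbourOfW : ∀ w → to π (nonNeighbourOfW w) ≡ w
    π-nonNeighbourOfW w =
      trans (cong (to π) (nonNeighbourOfW≡π⁻¹ w)) (Inverse.strictlyInverseˡ π↔ w)

    -- Both maps are inverse to `nonNeighbourOfW`, hence equal.
    nonNeighbourOfM≡π : ∀ m → nonNeighbourOfM m ≡ to π m
    nonNeighbourOfM≡π m = begin
      nonNeighbourOfM m
        ≡⟨ π-nonNeighbourOfW (nonNeighbourOfM m) ⟨
      to π (nonNeighbourOfW (nonNeighbourOfM m))
        ≡⟨ cong (to π) (nonNeighbourOfW-ofM antipodalRealization m) ⟩
      to π m ∎
      where open ≡-Reasoning

  matching⇒compatible : HasMutuallyLastPerfectMatching I → CubeDistanceCompatible I
  matching⇒compatible (π , last) =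
    antipodalRealization π ,
    (λ m → subst (RankedLast (prefM m)) (sym (nonNeighbourOfM≡π π m)) (proj₁ (last m))) ,
    -- The hypothesis at the non-neighbour of `w` concerns the preferences of its image under `π`;
    -- that image is `w`, so the transport changes the ranking agent.
    (λ w → subst (λ w′ → RankedLast (prefW w′) (nonNeighbourOfW w))
             (π-nonNeighbourOfW π w) (proj₂ (last (nonNeighbourOfW w))))
    where open StrongCubeRealization (antipodalRealization π) using (nonNeighbourOfW)

proposition7p3 : (I : PreferenceStructure 4) →
    CubeDistanceCompatible I ⇔ HasMutuallyLastPerfectMatching I
proposition7p3 I = mk⇔ (compatible⇒matching I) (matching⇒compatible I)
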